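{- Let $N$ be a positive integer which is not a perfect square, let $p$ be an integer with $p^2<N$, let $q$ be a positive integer dividing $N-p^2$, and put $\alpha=\frac{\sqrt N+p}{q}$. Let $(x_n)_{n\ge0}$ be the sequence of numbers in the left-positive path (LPP) of $\alpha$ and let $T$ be its least period. If $m\in\{1,2,\dots,T\}$ is such that $x_m=-\alpha^*$, then for every $n\in\{0,1,\dots,m\}$, $x_{m-n}=-x_n^*$, and $x_{n+1}$ and $x_{m-n}$ are either both left children or both right children of their parents in the LPP (where, for $n=m$, the number $x_0=\alpha$ is regarded as $x_T$, the child of $x_{T-1}$).
   Context: The Calkin-Wilf tree of $\alpha$ is the infinite binary tree whose root is labeled $\alpha$ and in which every vertex labeled $x$ has a left child labeled $\frac{x}{x+1}$ and a right child labeled $x+1$ (since $\alpha>0$, all labels are positive). Each vertex carries a triple $(\varepsilon,c,d)$ with $\varepsilon\in\{ -1,1\}$, $c$ an integer, $d$ a positive integer dividing $N-c^2$, and label equal to $\frac{\varepsilon\sqrt N+c}{d}$, defined as follows. The root has triple $(1,p,q)$. If a vertex has triple $(\varepsilon,c,d)$, its right child has triple $(\varepsilon,c+d,d)$; its left child has triple $\left(-\varepsilon,\frac{N-c^2}{d}-c,\frac{N-(c+d)^2}{d}\right)$ if $N-(c+d)^2>0$, and $\left(\varepsilon,c-\frac{N-c^2}{d},\frac{(c+d)^2-N}{d}\right)$ otherwise. The left-positive path (LPP) of $\alpha$ is the infinite descending path which starts at the root and which, from each vertex, goes to the left child if the value of $\varepsilon$ for that left child is $1$, and to the right child otherwise.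 $x_n$ denotes the label of the $n$-th vertex of the LPP, with $x_0=\alpha$. The parent of $x_{n+1}$ is $x_n$; "$x_{n+1}$ is the left (resp. right) child of $x_n$" means that the $(n+1)$-st step of the path, from $x_n$ to $x_{n+1}$, goes left (resp. right). The sequence $(x_n)$ is purely periodic, and $T$ denotes its least period, i.e. the least positive integer such that $x_T=\alpha$. For rational numbers $a,b$, the algebraic conjugate of $x=a\sqrt N+b$ is $x^*=-a\sqrt N+b$. -}

module Defs where

open import Data.Nat.Base as ℕ using (ℕ; zero; suc)
import Data.Nat.Properties as ℕ
import Data.Nat.Divisibility as ℕ
open import Data.Integer.Base as ℤ using (ℤ; +_; 0ℤ; 1ℤ; ∣_∣)
import Data.Integer.Properties as ℤ
import Data.Integer.DivMod as ℤ
open import Data.Integer.Divisibility.Signed using (_∣_; divides)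
open import Data.Integer.Tactic.RingSolver using (solve-∀)
open import Data.Rational.Base as ℚ using (ℚ; 0ℚ; 1ℚ)
import Data.Rational.Properties as ℚ
open import Data.List.Base using (List; []; _∷_)
open import Data.Product.Base using (_×_)
open import Data.Sign.Base as Sign using (Sign)
open import Data.Empty using (⊥-elim)
open import Relation.Nullary using (¬_; yes; no)
open import Relation.Binary.PropositionalEquality
  using (_≡_; _≢_; refl; sym; trans; cong; subst; module ≡-Reasoning)

NonSquare : ℕ → Set
NonSquare N = ∀ k → k ℕ.* k ≢ N

-- The field ℚ(√N) for non-square N.  Since 1 and √N are then linearly
-- independent over ℚ, two elements are equal as real numbers exactly when
-- their coordinates agree, i.e. when they are propositionally equal here.
module QuadraticField (N : ℕ) where

  infix 5 _√N+_

  record ℚ√N : Set where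
    constructor _√N+_
    field
      irr rat : ℚ

  infixl 7 _*_ _÷_
  infixl 6 _+_
  infix  8 -_
  infix  9 _⋆ _⁻¹

  1# : ℚ√N
  1# = 0ℚ √N+ 1ℚ

  _+_ : ℚ√N → ℚ√N → ℚ√N
  (a √N+ b) + (c √N+ d) = (a ℚ.+ c) √N+ (b ℚ.+ d)

  -_ : ℚ√N → ℚ√N
  - (a √N+ b) = (ℚ.- a) √N+ (ℚ.- b)

  _*_ : ℚ√N → ℚ√N → ℚ√N
  (a √N+ b) * (c √N+ d) =
    (a ℚ.* d ℚ.+ b ℚ.* c) √N+ ((+ N ℚ./ 1) ℚ.* (a ℚ.* c) ℚ.+ b ℚ.* d)

  -- Algebraic conjugation.
  _⋆ : ℚ√N → ℚ√N
  (a √N+ b) ⋆ = (ℚ.- a) √N+ b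

  norm : ℚ√N → ℚ
  norm (a √N+ b) = b ℚ.* b ℚ.- (+ N ℚ./ 1) ℚ.* (a ℚ.* a)

  -- x⁻¹ = x⋆ ÷ norm x.  For non-square N the norm vanishes only at 0, where
  -- the inverse is set to 0.
  _⁻¹ : ℚ√N → ℚ√N
  x@(a √N+ b) ⁻¹ with norm x ℚ.≟ 0ℚ
  ... | yes _    = 0ℚ √N+ 0ℚ
  ... | no  nx≢0 = (r ℚ.* (ℚ.- a)) √N+ (r ℚ.* b)
    where
    r : ℚ
    r = ℚ.1/_ (norm x) {{ℚ.≢-nonZero nx≢0}}

  _÷_ : ℚ√N → ℚ√N → ℚ√N
  x ÷ y = x * y ⁻¹

private
  positive⇒nonZero : ∀ i → .(ℤ.Positive i) → ℤ.NonZero i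
  positive⇒nonZero (+ suc _) _ = _

  positive⇒nonNegative : ∀ {i} → ℤ.Positive i → ℤ.NonNegative i
  positive⇒nonNegative {+ _} _ = _

  i<j⇒0<j-i : ∀ {i j} → i ℤ.< j → 0ℤ ℤ.< j ℤ.- i
  i<j⇒0<j-i {i} {j} i<j =
    subst (ℤ._< j ℤ.- i) (ℤ.+-inverseʳ i) (ℤ.+-monoˡ-< (ℤ.- i) i<j)

  /-exact : ∀ n d .{{_ : ℤ.NonZero d}} → d ∣ n → n ≡ (n ℤ./ d) ℤ.* d
  /-exact n d (divides k n≡kd) = begin
    n                                   ≡⟨ ℤ.a≡a%n+[a/n]*n n d ⟩
    + (n ℤ.% d) ℤ.+ (n ℤ./ d) ℤ.* d     ≡⟨ cong (λ r → + r ℤ.+ (n ℤ./ d) ℤ.* d) (r≡0 (n ℤ.% d) refl) ⟩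
    0ℤ ℤ.+ (n ℤ./ d) ℤ.* d              ≡⟨ ℤ.+-identityˡ _ ⟩
    (n ℤ./ d) ℤ.* d                     ∎
    where
    open ≡-Reasoning
    cancel : ∀ r e → r ≡ (r ℤ.+ e) ℤ.- e
    cancel = solve-∀
    factor : ∀ k f d → k ℤ.* d ℤ.- f ℤ.* d ≡ (k ℤ.- f) ℤ.* d
    factor = solve-∀
    rem : + (n ℤ.% d) ≡ (k ℤ.- n ℤ./ d) ℤ.* d
    rem = begin
      + (n ℤ.% d)
        ≡⟨ cancel (+ (n ℤ.% d)) ((n ℤ./ d) ℤ.* d) ⟩
      (+ (n ℤ.% d) ℤ.+ (n ℤ./ d) ℤ.* d) ℤ.- (n ℤ./ d) ℤ.* d
        ≡⟨ cong (λ z → z ℤ.- (n ℤ./ d) ℤ.* d) (trans (sym (ℤ.a≡a%n+[a/n]*n n d)) n≡kd) ⟩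
      k ℤ.* d ℤ.- (n ℤ./ d) ℤ.* d
        ≡⟨ factor k (n ℤ./ d) d ⟩
      (k ℤ.- n ℤ./ d) ℤ.* d ∎
    d∣r : ∣ d ∣ ℕ.∣ n ℤ.% d
    d∣r = ℕ.divides ∣ k ℤ.- n ℤ./ d ∣
      (trans (cong ∣_∣ rem) (ℤ.abs-* (k ℤ.- n ℤ./ d) d))
    r≡0 : ∀ r → r ≡ n ℤ.% d → r ≡ 0
    r≡0 zero    _  = refl
    r≡0 (suc r) eq = ⊥-elim (ℕ.>⇒∤ (subst (ℕ._< ∣ d ∣) (sym eq) (ℤ.n%d<d n d))
                                   (subst (∣ d ∣ ℕ.∣_) (sym eq) d∣r))

  /-positive : ∀ {n d} .{{_ : ℤ.NonZero d}} → ℤ.Positive d → d ∣ n → 0ℤ ℤ.< n →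
               ℤ.Positive (n ℤ./ d)
  /-positive {n} {d} d>0 d∣n 0<n = ℤ.positive
    (ℤ.*-cancelʳ-<-nonNeg d {{positive⇒nonNegative d>0}}
      (subst (ℤ._< (n ℤ./ d) ℤ.* d) (sym (ℤ.*-zeroˡ d))
        (subst (0ℤ ℤ.<_) (/-exact n d d∣n) 0<n)))

  module _ (n c d : ℤ) .{{_ : ℤ.NonZero d}} (d∣ : d ∣ n ℤ.- c ℤ.* c) where
    open ≡-Reasoning

    e g : ℤ
    e = (n ℤ.- c ℤ.* c) ℤ./ d
    g = e ℤ.- c ℤ.- c ℤ.- d

    complete : ∀ n s → n ≡ (n ℤ.- s) ℤ.+ s
    complete = solve-∀

    n≡ed+c² : n ≡ e ℤ.* d ℤ.+ c ℤ.* c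
    n≡ed+c² = trans (complete n (c ℤ.* c))
                    (cong (λ z → z ℤ.+ c ℤ.* c) (/-exact _ d d∣))

    right-∣ : d ∣ n ℤ.- (c ℤ.+ d) ℤ.* (c ℤ.+ d)
    right-∣ = divides g (trans (cong (λ z → z ℤ.- (c ℤ.+ d) ℤ.* (c ℤ.+ d)) n≡ed+c²) (alg e c d))
      where
      alg : ∀ e c d → (e ℤ.* d ℤ.+ c ℤ.* c) ℤ.- (c ℤ.+ d) ℤ.* (c ℤ.+ d)
                    ≡ (e ℤ.- c ℤ.- c ℤ.- d) ℤ.* d
      alg = solve-∀

    right-∣′ : d ∣ (c ℤ.+ d) ℤ.* (c ℤ.+ d) ℤ.- n
    right-∣′ = divides (ℤ.- g) (trans (cong (λ z → (c ℤ.+ d) ℤ.* (c ℤ.+ d) ℤ.- z) n≡ed+c²) (alg e c d))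
      where
      alg : ∀ e c d → (c ℤ.+ d) ℤ.* (c ℤ.+ d) ℤ.- (e ℤ.* d ℤ.+ c ℤ.* c)
                    ≡ (ℤ.- (e ℤ.- c ℤ.- c ℤ.- d)) ℤ.* d
      alg = solve-∀

    left⁺-∣ : (n ℤ.- (c ℤ.+ d) ℤ.* (c ℤ.+ d)) ℤ./ d ∣ n ℤ.- (e ℤ.- c) ℤ.* (e ℤ.- c)
    left⁺-∣ = divides (ℤ.- e) (begin
      n ℤ.- (e ℤ.- c) ℤ.* (e ℤ.- c)
        ≡⟨ cong (λ z → z ℤ.- (e ℤ.- c) ℤ.* (e ℤ.- c)) n≡ed+c² ⟩
      (e ℤ.* d ℤ.+ c ℤ.* c) ℤ.- (e ℤ.- c) ℤ.* (e ℤ.- c)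
        ≡⟨ alg e c d ⟩
      ℤ.- e ℤ.* g
        ≡⟨ cong (λ z → ℤ.- e ℤ.* z) (ℤ.*-cancelʳ-≡ g _ d
             (trans (sym (_∣_.equality right-∣)) (/-exact _ d right-∣))) ⟩
      ℤ.- e ℤ.* ((n ℤ.- (c ℤ.+ d) ℤ.* (c ℤ.+ d)) ℤ./ d) ∎)
      where
      alg : ∀ e c d → (e ℤ.* d ℤ.+ c ℤ.* c) ℤ.- (e ℤ.- c) ℤ.* (e ℤ.- c)
                    ≡ ℤ.- e ℤ.* (e ℤ.- c ℤ.- c ℤ.- d)
      alg = solve-∀

    left⁻-∣ : ((c ℤ.+ d) ℤ.* (c ℤ.+ d) ℤ.- n) ℤ./ d ∣ n ℤ.- (c ℤ.- e) ℤ.* (c ℤ.- e)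
    left⁻-∣ = divides e (begin
      n ℤ.- (c ℤ.- e) ℤ.* (c ℤ.- e)
        ≡⟨ cong (λ z → z ℤ.- (c ℤ.- e) ℤ.* (c ℤ.- e)) n≡ed+c² ⟩
      (e ℤ.* d ℤ.+ c ℤ.* c) ℤ.- (c ℤ.- e) ℤ.* (c ℤ.- e)
        ≡⟨ alg e c d ⟩
      e ℤ.* (ℤ.- g)
        ≡⟨ cong (e ℤ.*_) (ℤ.*-cancelʳ-≡ (ℤ.- g) _ d
             (trans (sym (_∣_.equality right-∣′)) (/-exact _ d right-∣′))) ⟩
      e ℤ.* (((c ℤ.+ d) ℤ.* (c ℤ.+ d) ℤ.- n) ℤ./ d) ∎)
      where
      alg : ∀ e c d → (e ℤ.* d ℤ.+ c ℤ.* c) ℤ.- (c ℤ.- e) ℤ.* (c ℤ.- e)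
                    ≡ e ℤ.* (ℤ.- (e ℤ.- c ℤ.- c ℤ.- d))
      alg = solve-∀

  square-gap : ∀ {N} → NonSquare N → ∀ s → ¬ (0ℤ ℤ.< + N ℤ.- s ℤ.* s) → 0ℤ ℤ.< s ℤ.* s ℤ.- + N
  square-gap {N} N≢□ s ≮ = i<j⇒0<j-i (ℤ.≤∧≢⇒< N≤s² N≢s²)
    where
    N≤s² : + N ℤ.≤ s ℤ.* s
    N≤s² = ℤ.≮⇒≥ (λ s²<N → ≮ (i<j⇒0<j-i s²<N))
    N≢s² : + N ≢ s ℤ.* s
    N≢s² eq = N≢□ ∣ s ∣ (trans (sym (ℤ.abs-* s s)) (sym (cong ∣_∣ eq)))

data Side : Set where
  left right : Side

module CalkinWilf (N : ℕ) .(N≢□ : NonSquare N) where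

  open QuadraticField N public

  record Triple : Set where
    constructor triple
    field
      ε    : Sign
      c    : ℤ
      d    : ℤ
      .d>0 : ℤ.Positive d
      .d∣  : d ∣ + N ℤ.- c ℤ.* c

  open Triple public using (ε; c; d)

  -- The divisions below are exact, by the divisibility invariant.
  leftTriple : Triple → Triple
  leftTriple (triple ε c d d>0 d∣) = child
    where
    instance
      d≢0 : ℤ.NonZero d
      d≢0 = positive⇒nonZero d d>0
    child : Triple
    child with 0ℤ ℤ.<? (+ N ℤ.- (c ℤ.+ d) ℤ.* (c ℤ.+ d))
    ... | yes 0<gap = triple
      (Sign.opposite ε)
      ((+ N ℤ.- c ℤ.* c) ℤ./ d ℤ.- c)
      ((+ N ℤ.- (c ℤ.+ d) ℤ.* (c ℤ.+ d)) ℤ./ d)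
      (/-positive d>0 (right-∣ (+ N) c d d∣) 0<gap)
      (left⁺-∣ (+ N) c d d∣)
    ... | no 0≮gap = triple
      ε
      (c ℤ.- (+ N ℤ.- c ℤ.* c) ℤ./ d)
      (((c ℤ.+ d) ℤ.* (c ℤ.+ d) ℤ.- + N) ℤ./ d)
      (/-positive d>0 (right-∣′ (+ N) c d d∣) (square-gap N≢□ (c ℤ.+ d) 0≮gap))
      (left⁻-∣ (+ N) c d d∣)

  rightTriple : Triple → Triple
  rightTriple (triple ε c d d>0 d∣) =
    triple ε (c ℤ.+ d) d d>0 (right-∣ (+ N) c d {{positive⇒nonZero d d>0}} d∣)

  childTriple : Side → Triple → Triple
  childTriple left  = leftTriple
  childTriple right = rightTriple

  childLabel : Side → ℚ√N → ℚ√N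
  childLabel left  x = x ÷ (x + 1#)
  childLabel right x = x + 1#

  module Tree (p : ℤ) (q : ℕ) .{{_ : ℕ.NonZero q}} .(q∣ : + q ∣ + N ℤ.- p ℤ.* p) where

    α : ℚ√N
    α = (1ℤ ℚ./ q) √N+ (p ℚ./ q)

    -- A vertex is the word of sides taken from the root, last step first.
    Vertex : Set
    Vertex = List Side

    label : Vertex → ℚ√N
    label []      = α
    label (s ∷ v) = childLabel s (label v)

    tripleAt : Vertex → Triple
    tripleAt []      = triple Sign.+ p (+ q) (ℤ.positive (ℤ.+<+ (ℕ.>-nonZero⁻¹ q))) q∣
    tripleAt (s ∷ v) = childTriple s (tripleAt v)

    step : Vertex → Side
    step v with ε (tripleAt (left ∷ v))
    ... | Sign.+ = left
    ... | Sign.- = right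

    lpp : ℕ → Vertex
    lpp zero    = []
    lpp (suc n) = step (lpp n) ∷ lpp n

    x : ℕ → ℚ√N
    x n = label (lpp n)

    IsLeastPeriod : ℕ → Set
    IsLeastPeriod T =
      0 ℕ.< T × x T ≡ α × (∀ k → 0 ℕ.< k → x k ≡ α → T ℕ.≤ k)

    -- Which child of its parent x_k is, given the least period T; for k = 0
    -- it is read as x_T, the child of x_{T-1}.
    childSide : (T k : ℕ) → Side
    childSide T zero    = step (lpp (ℕ.pred T))
    childSide T (suc k) = step (lpp k)

-- On the LPP every vertex has ε = 1, so its label is (√N + c) / d and, with
-- e = (N - c²) / d > 0, the path moves
--   right: (c , d , e) ↦ (c + d , d , e - 2c - d)   if e - 2c - d > 0,
--   left:  (c , d , e) ↦ (c - e , d + 2c - e , e)   if d + 2c - e > 0.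
-- The map x ↦ -x⋆ is c ↦ -c, and it turns each of these steps into a step of the
-- same side in the opposite direction.  As at most one step leaves a given
-- (c , d , e), the path read backwards from x_m = -α⋆ mirrors the path read
-- forwards from α.

module Submission where

open import Defs
open import Data.Nat.Base as ℕ using (ℕ; zero; suc; _∸_; NonZero)
import Data.Nat.Properties as ℕ
import Data.Nat.Divisibility as ℕ
open import Data.Integer.Base as ℤ using (ℤ; +_; 0ℤ; 1ℤ; ∣_∣)
import Data.Integer.Properties as ℤ
import Data.Integer.DivMod as ℤ
open import Data.Integer.Divisibility.Signed using (_∣_; ∣⇒∣ᵤ; ∣n⇒∣m*n; ∣m+n∣n⇒∣m; ∣-refl; divides)
import Data.Integer.Tactic.RingSolver as ℤ-Solver
open import Data.Rational.Base as ℚ using (ℚ; 0ℚ; 1ℚ)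
import Data.Rational.Properties as ℚ
open import Data.Rational.Unnormalised.Base as ℚᵘ using (mkℚᵘ; *≡*)
import Data.Rational.Unnormalised.Properties as ℚᵘ
open import Data.List.Base using ([]; _∷_)
open import Data.Product.Base using (_×_; _,_; proj₁; proj₂)
open import Data.Empty using (⊥; ⊥-elim)
import Data.Sign.Base as Sign
open import Data.Sum.Base using (_⊎_; inj₁; inj₂)
open import Relation.Nullary using (yes; no; contradiction; recompute; dec⇒maybe)
open import Relation.Binary.PropositionalEquality
  using (_≡_; refl; sym; trans; cong; cong₂; subst; module ≡-Reasoning)
open import Tactic.RingSolver using (solve-∀)
open import Tactic.RingSolver.Core.AlmostCommutativeRing using (AlmostCommutativeRing; fromCommutativeRing)
open import Level using (0ℓ)
open import Algebra.Properties.AbelianGroup ℤ.+-0-abelianGroup using (∙-cancelʳ)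

-- Auxiliary arithmetic of integers and rationals.

ℚ-ring : AlmostCommutativeRing 0ℓ 0ℓ
ℚ-ring = fromCommutativeRing ℚ.+-*-commutativeRing (λ q → dec⇒maybe (0ℚ ℚ.≟ q))

-- The divisor divides `n` and `(n / d) * d`, hence also the remainder, which is smaller than
-- `∣ d ∣` and so must vanish.
/-exact : ∀ n d .{{_ : ℤ.NonZero d}} → d ∣ n → (n ℤ./ d) ℤ.* d ≡ n
/-exact n d d∣n = begin
  (n ℤ./ d) ℤ.* d                  ≡⟨ ℤ.+-identityˡ _ ⟨
  0ℤ ℤ.+ (n ℤ./ d) ℤ.* d           ≡⟨ cong (λ r → + r ℤ.+ (n ℤ./ d) ℤ.* d) n%d≡0 ⟨
  + (n ℤ.% d) ℤ.+ (n ℤ./ d) ℤ.* d  ≡⟨ ℤ.a≡a%n+[a/n]*n n d ⟨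
  n                                ∎
  where
  open ≡-Reasoning
  d∣n%d : ∣ d ∣ ℕ.∣ n ℤ.% d
  d∣n%d = ∣⇒∣ᵤ {d} {+ (n ℤ.% d)} (∣m+n∣n⇒∣m (subst (d ∣_) (ℤ.a≡a%n+[a/n]*n n d) d∣n)
                          (∣n⇒∣m*n (n ℤ./ d) ∣-refl))
  n%d≡0 : n ℤ.% d ≡ 0
  n%d≡0 with n ℤ.% d | d∣n%d | ℤ.n%d<d n d
  ... | zero  | _   | _   = refl
  ... | suc _ | d∣r | r<d = contradiction d∣r (ℕ.>⇒∤ r<d)

pos*pos : ∀ {i j} → 0ℤ ℤ.< j → 0ℤ ℤ.< i ℤ.* j → 0ℤ ℤ.< i
pos*pos {i} {j} 0<j 0<ij = ℤ.*-cancelʳ-<-nonNeg j {{ℤ.nonNegative (ℤ.<⇒≤ 0<j)}}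
  (subst (ℤ._< i ℤ.* j) (sym (ℤ.*-zeroˡ j)) 0<ij)

<⇒0<- : ∀ {i j} → i ℤ.< j → 0ℤ ℤ.< j ℤ.- i
<⇒0<- {i} {j} i<j = subst (ℤ._< j ℤ.- i) (ℤ.+-inverseʳ i) (ℤ.+-monoˡ-< (ℤ.- i) i<j)

fromℚᵘ-homo-+ : ∀ p q → ℚ.fromℚᵘ (p ℚᵘ.+ q) ≡ ℚ.fromℚᵘ p ℚ.+ ℚ.fromℚᵘ q
fromℚᵘ-homo-+ p q = ℚ.toℚᵘ-injective (begin
  ℚ.toℚᵘ (ℚ.fromℚᵘ (p ℚᵘ.+ q))                          ≈⟨ ℚ.toℚᵘ-fromℚᵘ (p ℚᵘ.+ q) ⟩
  p ℚᵘ.+ q                                              ≈⟨ ℚᵘ.+-cong (ℚ.toℚᵘ-fromℚᵘ p) (ℚ.toℚᵘ-fromℚᵘ q) ⟨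
  ℚ.toℚᵘ (ℚ.fromℚᵘ p) ℚᵘ.+ ℚ.toℚᵘ (ℚ.fromℚᵘ q)          ≈⟨ ℚ.toℚᵘ-homo-+ (ℚ.fromℚᵘ p) (ℚ.fromℚᵘ q) ⟨
  ℚ.toℚᵘ (ℚ.fromℚᵘ p ℚ.+ ℚ.fromℚᵘ q)                    ∎)
  where open import Relation.Binary.Reasoning.Setoid ℚᵘ.≃-setoid

fromℚᵘ-homo-* : ∀ p q → ℚ.fromℚᵘ (p ℚᵘ.* q) ≡ ℚ.fromℚᵘ p ℚ.* ℚ.fromℚᵘ q
fromℚᵘ-homo-* p q = ℚ.toℚᵘ-injective (begin
  ℚ.toℚᵘ (ℚ.fromℚᵘ (p ℚᵘ.* q))                          ≈⟨ ℚ.toℚᵘ-fromℚᵘ (p ℚᵘ.* q) ⟩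
  p ℚᵘ.* q                                              ≈⟨ ℚᵘ.*-cong (ℚ.toℚᵘ-fromℚᵘ p) (ℚ.toℚᵘ-fromℚᵘ q) ⟨
  ℚ.toℚᵘ (ℚ.fromℚᵘ p) ℚᵘ.* ℚ.toℚᵘ (ℚ.fromℚᵘ q)          ≈⟨ ℚ.toℚᵘ-homo-* (ℚ.fromℚᵘ p) (ℚ.fromℚᵘ q) ⟨
  ℚ.toℚᵘ (ℚ.fromℚᵘ p ℚ.* ℚ.fromℚᵘ q)                    ∎)
  where open import Relation.Binary.Reasoning.Setoid ℚᵘ.≃-setoid

-- `fromℚᵘ (mkℚᵘ i 0)` computes to `i / 1`, so facts about `ι` can be checked on unnormalised
-- fractions.
ι : ℤ → ℚ
ι i = i ℚ./ 1

ι-injective : ∀ {i j} → ι i ≡ ι j → i ≡ j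
ι-injective {i} {j} eq with *≡* i1≡j1 ← ℚ.fromℚᵘ-injective {mkℚᵘ i 0} {mkℚᵘ j 0} eq =
  ℤ.*-cancelʳ-≡ i j 1ℤ i1≡j1

ι-homo-+ : ∀ i j → ι (i ℤ.+ j) ≡ ι i ℚ.+ ι j
ι-homo-+ i j = trans
  -- The unnormalised sum has numerator `i * 1 + j * 1`.
  (cong ι (sym (cong₂ ℤ._+_ (ℤ.*-identityʳ i) (ℤ.*-identityʳ j))))
  (fromℚᵘ-homo-+ (mkℚᵘ i 0) (mkℚᵘ j 0))

ι-homo-* : ∀ i j → ι (i ℤ.* j) ≡ ι i ℚ.* ι j
ι-homo-* i j = fromℚᵘ-homo-* (mkℚᵘ i 0) (mkℚᵘ j 0)

ι-homo-neg : ∀ i → ι (ℤ.- i) ≡ ℚ.- ι i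
ι-homo-neg i = begin
  ι (ℤ.- i)                            ≡⟨ add-sub (ι (ℤ.- i)) (ι i) ⟩
  (ι (ℤ.- i) ℚ.+ ι i) ℚ.- ι i          ≡⟨ cong (ℚ._- ι i) (ι-homo-+ (ℤ.- i) i) ⟨
  ι (ℤ.- i ℤ.+ i) ℚ.- ι i              ≡⟨ cong (λ j → ι j ℚ.- ι i) (ℤ.+-inverseˡ i) ⟩
  0ℚ ℚ.- ι i                           ≡⟨ ℚ.+-identityˡ (ℚ.- ι i) ⟩
  ℚ.- ι i                              ∎
  where
  open ≡-Reasoning
  add-sub : ∀ a b → a ≡ (a ℚ.+ b) ℚ.- b
  add-sub = solve-∀ ℚ-ring

/-clear : ∀ p q .{{_ : NonZero q}} → (p ℚ./ q) ℚ.* ι (+ q) ≡ ι p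
/-clear p (suc q) = trans (sym (fromℚᵘ-homo-* (mkℚᵘ p q) (mkℚᵘ (+ suc q) 0)))
  (ℚ.fromℚᵘ-cong {mkℚᵘ p q ℚᵘ.* mkℚᵘ (+ suc q) 0} {mkℚᵘ p 0} (*≡* (trans (ℤ.*-identityʳ _) (cong (λ k → p ℤ.* + k) (sym (ℕ.*-identityʳ (suc q)))))))

-- Forms and the steps between them.

-- ⟨ c , d , e ⟩ stands for (√N + c) / d with d e = N - c²; in these coordinates
-- the steps of the LPP do not mention N.
infix 5 ⟨_,_,_⟩
record Form : Set where
  constructor ⟨_,_,_⟩
  field
    c d e : ℤ

conj : Form → Form
conj ⟨ c , d , e ⟩ = ⟨ ℤ.- c , d , e ⟩

conj-involutive : ∀ s → conj (conj s) ≡ s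
conj-involutive ⟨ c , d , e ⟩ = cong (λ z → ⟨ z , d , e ⟩) (ℤ.neg-involutive c)

infix 4 _⟶[_]_
-- Both the old and the new value of the changing entry are required to be positive, so that source
-- and target can be exchanged.
data _⟶[_]_ : Form → Side → Form → Set where
  ⟶-right : ∀ {c d e c′ e′} → c′ ≡ c ℤ.+ d → e ≡ e′ ℤ.+ (c ℤ.+ c′) →
            0ℤ ℤ.< e → 0ℤ ℤ.< e′ → ⟨ c , d , e ⟩ ⟶[ right ] ⟨ c′ , d , e′ ⟩
  ⟶-left  : ∀ {c d e c′ d′} → c ≡ c′ ℤ.+ e → d′ ≡ d ℤ.+ (c ℤ.+ c′) →
            0ℤ ℤ.< d → 0ℤ ℤ.< d′ → ⟨ c , d , e ⟩ ⟶[ left ] ⟨ c′ , d′ , e ⟩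

-- Negating both values of `c` turns each equation into a rearrangement of itself read from target
-- to source, and the two positivity conditions change places.
⟶-reverse : ∀ {s t σ} → s ⟶[ σ ] t → conj t ⟶[ σ ] conj s
⟶-reverse (⟶-right {c} {d} {e′ = e′} refl refl 0<e 0<e′) = ⟶-right (alg₁ c d) (alg₂ c d e′) 0<e′ 0<e
  where
  alg₁ : ∀ c d → ℤ.- c ≡ ℤ.- (c ℤ.+ d) ℤ.+ d
  alg₁ = ℤ-Solver.solve-∀
  alg₂ : ∀ c d e′ → e′ ≡ (e′ ℤ.+ (c ℤ.+ (c ℤ.+ d))) ℤ.+ (ℤ.- (c ℤ.+ d) ℤ.+ ℤ.- c)
  alg₂ = ℤ-Solver.solve-∀
⟶-reverse (⟶-left {d = d} {e} {c′} refl refl 0<d 0<d′) = ⟶-left (alg₁ c′ e) (alg₂ c′ d e) 0<d′ 0<d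
  where
  alg₁ : ∀ c′ e → ℤ.- c′ ≡ ℤ.- (c′ ℤ.+ e) ℤ.+ e
  alg₁ = ℤ-Solver.solve-∀
  alg₂ : ∀ c′ d e → d ≡ (d ℤ.+ ((c′ ℤ.+ e) ℤ.+ c′)) ℤ.+ (ℤ.- c′ ℤ.+ ℤ.- (c′ ℤ.+ e))
  alg₂ = ℤ-Solver.solve-∀

-- A right step needs `e - 2c - d` to be positive and a left step needs `d + 2c - e` to be positive,
-- but these two numbers add up to zero.
¬left∧right : ∀ {s t u} → s ⟶[ left ] t → s ⟶[ right ] u → ⊥
¬left∧right (⟶-left {d = d} {e} {c′} refl refl _ 0<d′) (⟶-right {e′ = e′} refl eq _ 0<e′) =
  ℤ.<-irrefl (sym sum≡0) (ℤ.+-mono-< 0<e′ 0<d′)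
  where
  alg : ∀ c′ d e e′ → e′ ℤ.+ (d ℤ.+ ((c′ ℤ.+ e) ℤ.+ c′))
                    ≡ (e′ ℤ.+ ((c′ ℤ.+ e) ℤ.+ ((c′ ℤ.+ e) ℤ.+ d))) ℤ.- e
  alg = ℤ-Solver.solve-∀
  sum≡0 : e′ ℤ.+ (d ℤ.+ ((c′ ℤ.+ e) ℤ.+ c′)) ≡ 0ℤ
  sum≡0 = trans (alg c′ d e e′) (ℤ.i≡j⇒i-j≡0 (sym eq))

⟶-deterministic : ∀ {s t u σ τ} → s ⟶[ σ ] t → s ⟶[ τ ] u → σ ≡ τ × t ≡ u
⟶-deterministic (⟶-right {e′ = e₁} refl eq₁ _ _) (⟶-right {e′ = e₂} refl eq₂ _ _)
  with refl ← ∙-cancelʳ _ e₁ e₂ (trans (sym eq₁) eq₂) = refl , refl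
⟶-deterministic (⟶-left {c′ = c₁} eq₁ refl _ _) (⟶-left {c′ = c₂} eq₂ refl _ _)
  with refl ← ∙-cancelʳ _ c₁ c₂ (trans (sym eq₁) eq₂) = refl , refl
⟶-deterministic s⟶t@(⟶-right _ _ _ _) s⟶u@(⟶-left _ _ _ _) = ⊥-elim (¬left∧right s⟶u s⟶t)
⟶-deterministic s⟶t@(⟶-left _ _ _ _) s⟶u@(⟶-right _ _ _ _) = ⊥-elim (¬left∧right s⟶t s⟶u)

-- Labels as elements of the quadratic field.

module Labels (N : ℕ) where
  open QuadraticField N

  -- `r` certifies that the norm of `y` is not zero, which excludes the default value of the
  -- inverse. In the other branch `norm y` cancels from both coordinates of `z * y * y ⁻¹`.
  ÷-unique : ∀ x y z r → norm y ℚ.* r ≡ 1ℚ → z * y ≡ x → x ÷ y ≡ z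
  ÷-unique _ y@(a √N+ b) z@(u √N+ v) r nr≡1 refl with norm y ℚ.≟ 0ℚ
  ... | yes n≡0 = contradiction (trans (sym nr≡1) (trans (cong (ℚ._* r) n≡0) (ℚ.*-zeroˡ r))) λ ()
  ... | no n≢0 = cong₂ _√N+_
    (trans (alg₁ (ι (+ N)) a b u v (ℚ.1/ norm y)) (trans (cong (u ℚ.*_) (ℚ.*-inverseʳ (norm y))) (ℚ.*-identityʳ u)))
    (trans (alg₂ (ι (+ N)) a b u v (ℚ.1/ norm y)) (trans (cong (v ℚ.*_) (ℚ.*-inverseʳ (norm y))) (ℚ.*-identityʳ v)))
    where
    instance
      norm≢0 : ℚ.NonZero (norm y)
      norm≢0 = ℚ.≢-nonZero n≢0
    alg₁ : ∀ n a b u v s →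
      (u ℚ.* b ℚ.+ v ℚ.* a) ℚ.* (s ℚ.* b) ℚ.+ (n ℚ.* (u ℚ.* a) ℚ.+ v ℚ.* b) ℚ.* (s ℚ.* (ℚ.- a))
      ≡ u ℚ.* ((b ℚ.* b ℚ.- n ℚ.* (a ℚ.* a)) ℚ.* s)
    alg₁ = solve-∀ ℚ-ring
    alg₂ : ∀ n a b u v s →
      n ℚ.* ((u ℚ.* b ℚ.+ v ℚ.* a) ℚ.* (s ℚ.* (ℚ.- a))) ℚ.+ (n ℚ.* (u ℚ.* a) ℚ.+ v ℚ.* b) ℚ.* (s ℚ.* b)
      ≡ v ℚ.* ((b ℚ.* b ℚ.- n ℚ.* (a ℚ.* a)) ℚ.* s)
    alg₂ = solve-∀ ℚ-ring

  infix 4 _Represents_/_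
  -- z = (√N + c) / d
  record _Represents_/_ (z : ℚ√N) (c d : ℤ) : Set where
    constructor represent
    field
      irr*d≡1   : ℚ√N.irr z ℚ.* ι d ≡ 1ℚ
      rat≡c*irr : ℚ√N.rat z ≡ ι c ℚ.* ℚ√N.irr z

  inverse-unique : ∀ {a u v} → u ℚ.* a ≡ 1ℚ → v ℚ.* a ≡ 1ℚ → u ≡ v
  inverse-unique {a} {u} {v} ua≡1 va≡1 = begin
    u                  ≡⟨ ℚ.*-identityʳ u ⟨
    u ℚ.* 1ℚ           ≡⟨ cong (u ℚ.*_) va≡1 ⟨
    u ℚ.* (v ℚ.* a)    ≡⟨ alg u v a ⟩
    v ℚ.* (u ℚ.* a)    ≡⟨ cong (v ℚ.*_) ua≡1 ⟩
    v ℚ.* 1ℚ           ≡⟨ ℚ.*-identityʳ v ⟩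
    v                  ∎
    where
    open ≡-Reasoning
    alg : ∀ u v a → u ℚ.* (v ℚ.* a) ≡ v ℚ.* (u ℚ.* a)
    alg = solve-∀ ℚ-ring

  represents-unique : ∀ {z w c d} → z Represents c / d → w Represents c / d → z ≡ w
  represents-unique {u √N+ _} {v √N+ _} {c} (represent ud≡1 refl) (represent vd≡1 refl) =
    cong (λ r → r √N+ (ι c ℚ.* r)) (inverse-unique ud≡1 vd≡1)

  -- `d` is the inverse of the irrational coordinate and `c` the ratio of the two coordinates.
  -- Equations between labels thereby become equations between integers.
  represents-injective : ∀ {z c d c′ d′} → z Represents c / d → z Represents c′ / d′ → c ≡ c′ × d ≡ d′
  represents-injective {u √N+ _} {c} {d} {c′} {d′} (represent ud≡1 eq) (represent ud′≡1 eq′) =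
    ι-injective ιc≡ιc′ ,
    ι-injective (inverse-unique {u} (trans (ℚ.*-comm (ι d) u) ud≡1) (trans (ℚ.*-comm (ι d′) u) ud′≡1))
    where
    ιc≡ιc′ : ι c ≡ ι c′
    ιc≡ιc′ = begin
      ι c                        ≡⟨ ℚ.*-identityʳ (ι c) ⟨
      ι c ℚ.* 1ℚ                 ≡⟨ cong (ι c ℚ.*_) ud≡1 ⟨
      ι c ℚ.* (u ℚ.* ι d)        ≡⟨ ℚ.*-assoc (ι c) u (ι d) ⟨
      (ι c ℚ.* u) ℚ.* ι d        ≡⟨ cong (ℚ._* ι d) (trans (sym eq) eq′) ⟩
      (ι c′ ℚ.* u) ℚ.* ι d       ≡⟨ ℚ.*-assoc (ι c′) u (ι d) ⟩
      ι c′ ℚ.* (u ℚ.* ι d)       ≡⟨ cong (ι c′ ℚ.*_) ud≡1 ⟩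
      ι c′ ℚ.* 1ℚ                ≡⟨ ℚ.*-identityʳ (ι c′) ⟩
      ι c′                       ∎
      where open ≡-Reasoning

  -- The two sign changes cancel on the irrational coordinate, while the rational one is negated
  -- once.
  represents-conj : ∀ {z c d} → z Represents c / d → (- z ⋆) Represents (ℤ.- c) / d
  represents-conj {u √N+ _} {c} {d} (represent ud≡1 refl) =
    represent
      (trans (cong (ℚ._* ι d) (neg-neg u)) ud≡1)
      (trans (alg (ι c) u) (cong (ℚ._* (ℚ.- (ℚ.- u))) (sym (ι-homo-neg c))))
    where
    neg-neg : ∀ a → ℚ.- (ℚ.- a) ≡ a
    neg-neg = solve-∀ ℚ-ring
    alg : ∀ c u → ℚ.- (c ℚ.* u) ≡ (ℚ.- c) ℚ.* (ℚ.- (ℚ.- u))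
    alg = solve-∀ ℚ-ring

  -- With `c - c′` in the role of `e`, the first hypothesis is `N = c² + e d`, and `d + (c + c′)` is
  -- the denominator `d′` of the left child.
  ÷-quotient : ∀ u v c c′ d → ι (+ N) ≡ c ℚ.* c ℚ.+ (c ℚ.- c′) ℚ.* d →
               u ℚ.* d ≡ 1ℚ → v ℚ.* (d ℚ.+ (c ℚ.+ c′)) ≡ 1ℚ →
               (u √N+ (c ℚ.* u)) ÷ (u √N+ ((c ℚ.+ d) ℚ.* u)) ≡ v √N+ (c′ ℚ.* v)
  ÷-quotient u v c c′ d N≡ ud≡1 vd′≡1 =
    -- The divisor has norm `u² ((c + d)² - N) = u² d d′ = d′ / d`, whose inverse is `v * d`.
    ÷-unique (u √N+ (c ℚ.* u)) (u √N+ ((c ℚ.+ d) ℚ.* u)) (v √N+ (c′ ℚ.* v)) (v ℚ.* d) inverse (cong₂ _√N+_ irr≡ rat≡)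
    where
    open ≡-Reasoning
    s : ℚ
    s = (c ℚ.+ d) ℚ.* u
    d′ : ℚ
    d′ = d ℚ.+ (c ℚ.+ c′)
    alg₁ : ∀ u v c c′ d →
      (((c ℚ.+ d) ℚ.* u) ℚ.* ((c ℚ.+ d) ℚ.* u) ℚ.- (c ℚ.* c ℚ.+ (c ℚ.- c′) ℚ.* d) ℚ.* (u ℚ.* u)) ℚ.* (v ℚ.* d)
      ≡ ((u ℚ.* d) ℚ.* (u ℚ.* d)) ℚ.* (v ℚ.* (d ℚ.+ (c ℚ.+ c′)))
    alg₁ = solve-∀ ℚ-ring
    alg₂ : ∀ u v c c′ d → v ℚ.* ((c ℚ.+ d) ℚ.* u) ℚ.+ (c′ ℚ.* v) ℚ.* u
                        ≡ u ℚ.* (v ℚ.* (d ℚ.+ (c ℚ.+ c′)))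
    alg₂ = solve-∀ ℚ-ring
    alg₃ : ∀ u v c c′ d →
      (c ℚ.* c ℚ.+ (c ℚ.- c′) ℚ.* d) ℚ.* (v ℚ.* u) ℚ.+ (c′ ℚ.* v) ℚ.* ((c ℚ.+ d) ℚ.* u)
      ≡ (c ℚ.* u) ℚ.* (v ℚ.* (d ℚ.+ (c ℚ.+ c′)))
    alg₃ = solve-∀ ℚ-ring
    inverse : (s ℚ.* s ℚ.- ι (+ N) ℚ.* (u ℚ.* u)) ℚ.* (v ℚ.* d) ≡ 1ℚ
    inverse = begin
      (s ℚ.* s ℚ.- ι (+ N) ℚ.* (u ℚ.* u)) ℚ.* (v ℚ.* d)
        ≡⟨ cong (λ n → (s ℚ.* s ℚ.- n ℚ.* (u ℚ.* u)) ℚ.* (v ℚ.* d)) N≡ ⟩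
      (s ℚ.* s ℚ.- (c ℚ.* c ℚ.+ (c ℚ.- c′) ℚ.* d) ℚ.* (u ℚ.* u)) ℚ.* (v ℚ.* d)
        ≡⟨ alg₁ u v c c′ d ⟩
      ((u ℚ.* d) ℚ.* (u ℚ.* d)) ℚ.* (v ℚ.* d′)
        ≡⟨ cong₂ (λ k l → (k ℚ.* k) ℚ.* l) ud≡1 vd′≡1 ⟩
      1ℚ ∎
    irr≡ : v ℚ.* s ℚ.+ (c′ ℚ.* v) ℚ.* u ≡ u
    irr≡ = begin
      v ℚ.* s ℚ.+ (c′ ℚ.* v) ℚ.* u  ≡⟨ alg₂ u v c c′ d ⟩
      u ℚ.* (v ℚ.* d′)              ≡⟨ cong (u ℚ.*_) vd′≡1 ⟩
      u ℚ.* 1ℚ                      ≡⟨ ℚ.*-identityʳ u ⟩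
      u                             ∎
    rat≡ : ι (+ N) ℚ.* (v ℚ.* u) ℚ.+ (c′ ℚ.* v) ℚ.* s ≡ c ℚ.* u
    rat≡ = begin
      ι (+ N) ℚ.* (v ℚ.* u) ℚ.+ (c′ ℚ.* v) ℚ.* s
        ≡⟨ cong (λ n → n ℚ.* (v ℚ.* u) ℚ.+ (c′ ℚ.* v) ℚ.* s) N≡ ⟩
      (c ℚ.* c ℚ.+ (c ℚ.- c′) ℚ.* d) ℚ.* (v ℚ.* u) ℚ.+ (c′ ℚ.* v) ℚ.* s
        ≡⟨ alg₃ u v c c′ d ⟩
      (c ℚ.* u) ℚ.* (v ℚ.* d′)
        ≡⟨ cong ((c ℚ.* u) ℚ.*_) vd′≡1 ⟩
      (c ℚ.* u) ℚ.* 1ℚ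
        ≡⟨ ℚ.*-identityʳ (c ℚ.* u) ⟩
      c ℚ.* u ∎

  √N+1# : ∀ u c d → u ℚ.* d ≡ 1ℚ → (u √N+ (c ℚ.* u)) + 1# ≡ u √N+ ((c ℚ.+ d) ℚ.* u)
  √N+1# u c d ud≡1 = cong₂ _√N+_ (ℚ.+-identityʳ u) (begin
    c ℚ.* u ℚ.+ 1ℚ        ≡⟨ cong (c ℚ.* u ℚ.+_) ud≡1 ⟨
    c ℚ.* u ℚ.+ u ℚ.* d   ≡⟨ alg c d u ⟩
    (c ℚ.+ d) ℚ.* u       ∎)
    where
    open ≡-Reasoning
    alg : ∀ c d u → c ℚ.* u ℚ.+ u ℚ.* d ≡ (c ℚ.+ d) ℚ.* u
    alg = solve-∀ ℚ-ring

  represents-right : ∀ {z c d} → z Represents c / d → (z + 1#) Represents (c ℤ.+ d) / d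
  represents-right {u √N+ _} {c} {d} (represent ud≡1 refl) =
    subst (_Represents (c ℤ.+ d) / d) (sym (√N+1# u (ι c) (ι d) ud≡1))
      (represent ud≡1 (cong (ℚ._* u) (sym (ι-homo-+ c d))))

  represents-left : ∀ {z c d c′ d′} → + N ≡ c ℤ.* c ℤ.+ (c ℤ.- c′) ℤ.* d → d′ ≡ d ℤ.+ (c ℤ.+ c′) →
                    0ℤ ℤ.< d′ → z Represents c / d → (z ÷ (z + 1#)) Represents c′ / d′
  represents-left {u √N+ _} {c} {d} {c′} {d′} N≡ d′≡ 0<d′ (represent ud≡1 refl) =
    subst (_Represents c′ / d′) (sym quotient) (represent vd′≡1 refl)
    where
    instance
      ιd′≢0 : ℚ.NonZero (ι d′)
      ιd′≢0 = ℚ.≢-nonZero (λ eq → ℤ.<-irrefl (sym (ι-injective {d′} {0ℤ} eq)) 0<d′)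
    v : ℚ
    v = ℚ.1/ ι d′
    vd′≡1 : v ℚ.* ι d′ ≡ 1ℚ
    vd′≡1 = ℚ.*-inverseˡ (ι d′)
    ιd′≡ : ι d′ ≡ ι d ℚ.+ (ι c ℚ.+ ι c′)
    ιd′≡ = begin
      ι d′                        ≡⟨ cong ι d′≡ ⟩
      ι (d ℤ.+ (c ℤ.+ c′))        ≡⟨ ι-homo-+ d (c ℤ.+ c′) ⟩
      ι d ℚ.+ ι (c ℤ.+ c′)        ≡⟨ cong (ι d ℚ.+_) (ι-homo-+ c c′) ⟩
      ι d ℚ.+ (ι c ℚ.+ ι c′)      ∎
      where open ≡-Reasoning
    ιN≡ : ι (+ N) ≡ ι c ℚ.* ι c ℚ.+ (ι c ℚ.- ι c′) ℚ.* ι d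
    ιN≡ = begin
      ι (+ N)                                               ≡⟨ cong ι N≡ ⟩
      ι (c ℤ.* c ℤ.+ (c ℤ.- c′) ℤ.* d)                      ≡⟨ ι-homo-+ (c ℤ.* c) ((c ℤ.- c′) ℤ.* d) ⟩
      ι (c ℤ.* c) ℚ.+ ι ((c ℤ.- c′) ℤ.* d)                  ≡⟨ cong₂ ℚ._+_ (ι-homo-* c c) (ι-homo-* (c ℤ.- c′) d) ⟩
      ι c ℚ.* ι c ℚ.+ ι (c ℤ.- c′) ℚ.* ι d                  ≡⟨ cong (λ r → ι c ℚ.* ι c ℚ.+ r ℚ.* ι d) (ι-homo-+ c (ℤ.- c′)) ⟩
      ι c ℚ.* ι c ℚ.+ (ι c ℚ.+ ι (ℤ.- c′)) ℚ.* ι d          ≡⟨ cong (λ r → ι c ℚ.* ι c ℚ.+ (ι c ℚ.+ r) ℚ.* ι d) (ι-homo-neg c′) ⟩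
      ι c ℚ.* ι c ℚ.+ (ι c ℚ.- ι c′) ℚ.* ι d                ∎
      where open ≡-Reasoning
    z : ℚ√N
    z = u √N+ (ι c ℚ.* u)
    quotient : z ÷ (z + 1#) ≡ v √N+ (ι c′ ℚ.* v)
    quotient = trans (cong (z ÷_) (√N+1# u (ι c) (ι d) ud≡1))
      (÷-quotient u v (ι c) (ι c′) (ι d) ιN≡ ud≡1 (trans (cong (v ℚ.*_) (sym ιd′≡)) vd′≡1))

-- Triples and their children, read as forms.

positive⇒nonZero : ∀ {i} → .(ℤ.Positive i) → ℤ.NonZero i
positive⇒nonZero {+ suc _} _ = _

module Triples (N : ℕ) .(N≢□ : NonSquare N) where
  open CalkinWilf N N≢□ hiding (_+_; _*_; -_)

  -- The entry `e` of forms, which a triple does not store.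
  cofactor : Triple → ℤ
  cofactor (triple _ c d d>0 _) = ((+ N ℤ.- c ℤ.* c) ℤ./ d) {{positive⇒nonZero d>0}}

  cofactor*d : ∀ t → cofactor t ℤ.* d t ≡ + N ℤ.- c t ℤ.* c t
  cofactor*d (triple _ c d d>0 d∣) =
    -- `d>0` and `d∣` are irrelevant, so the equation derived from them has to be rebuilt by
    -- deciding it.
    recompute (_ ℤ.≟ _) (/-exact (+ N ℤ.- c ℤ.* c) d {{positive⇒nonZero d>0}} d∣)

  N≡ : ∀ t → + N ≡ cofactor t ℤ.* d t ℤ.+ c t ℤ.* c t
  N≡ t = trans (alg (+ N) (c t ℤ.* c t)) (cong (ℤ._+ c t ℤ.* c t) (sym (cofactor*d t)))
    where
    alg : ∀ n k → n ≡ (n ℤ.- k) ℤ.+ k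
    alg = ℤ-Solver.solve-∀

  0<d : ∀ t → 0ℤ ℤ.< d t
  0<d (triple _ _ d d>0 _) = recompute (0ℤ ℤ.<? d) (ℤ.positive⁻¹ d {{d>0}})

  formOf : Triple → Form
  formOf t = ⟨ c t , d t , cofactor t ⟩

  cancel-d : ∀ t i j → i ℤ.* d t ≡ j ℤ.* d t → i ≡ j
  cancel-d t i j = ℤ.*-cancelʳ-≡ i j (d t) {{ℤ.≢-nonZero (λ eq → ℤ.<-irrefl (sym eq) (0<d t))}}

  -- As `d` is nonzero, `N = e d + c²` leaves only one choice for `e`. Hence labels, which show only
  -- `c` and `d`, determine forms.
  form-determined : ∀ t (s : Form) → c t ≡ Form.c s → d t ≡ Form.d s →
                    + N ≡ Form.e s ℤ.* Form.d s ℤ.+ Form.c s ℤ.* Form.c s → formOf t ≡ s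
  form-determined t ⟨ _ , _ , e ⟩ refl refl N≡ed+c² =
    cong (λ z → ⟨ c t , d t , z ⟩)
      (cancel-d t _ _ (∙-cancelʳ _ _ _ (trans (sym (N≡ t)) N≡ed+c²)))

  0<cofactor-right : ∀ t → 0ℤ ℤ.< + N ℤ.- (c t ℤ.+ d t) ℤ.* (c t ℤ.+ d t) → 0ℤ ℤ.< cofactor (rightTriple t)
  0<cofactor-right t 0<gap = pos*pos (0<d t) (subst (0ℤ ℤ.<_) (sym (cofactor*d (rightTriple t))) 0<gap)

  rightTriple-step : ∀ t → 0ℤ ℤ.< cofactor t → 0ℤ ℤ.< + N ℤ.- (c t ℤ.+ d t) ℤ.* (c t ℤ.+ d t) →
                     formOf t ⟶[ right ] formOf (rightTriple t)
  rightTriple-step t 0<e 0<gap = ⟶-right refl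
    -- Multiplied by `d`, the equation compares `N - c²` with `N - (c + d)²`, which differ by
    -- `(c + c′) d`.
    (cancel-d t (cofactor t) _ (trans (cofactor*d t) (trans (alg (+ N) (c t) (d t))
      (trans (cong (ℤ._+ (c t ℤ.+ (c t ℤ.+ d t)) ℤ.* d t) (sym (cofactor*d (rightTriple t))))
             (sym (ℤ.*-distribʳ-+ (d t) (cofactor (rightTriple t)) _))))))
    0<e
    (0<cofactor-right t 0<gap)
    where
    alg : ∀ n c d → n ℤ.- c ℤ.* c ≡ (n ℤ.- (c ℤ.+ d) ℤ.* (c ℤ.+ d)) ℤ.+ (c ℤ.+ (c ℤ.+ d)) ℤ.* d
    alg = ℤ-Solver.solve-∀

  -- If the sign flips, the path will turn right, and all that is kept is the inequality that makes
  -- the right step legal. Otherwise `(c + d)² - N = (d + 2c - e) d` removes the division from the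
  -- new `d`.
  leftTriple-cases : ∀ t →
    (ε (leftTriple t) ≡ Sign.opposite (ε t) × 0ℤ ℤ.< + N ℤ.- (c t ℤ.+ d t) ℤ.* (c t ℤ.+ d t))
    ⊎ (ε (leftTriple t) ≡ ε t × c (leftTriple t) ≡ c t ℤ.- cofactor t
       × d (leftTriple t) ≡ d t ℤ.+ (c t ℤ.+ (c t ℤ.- cofactor t)))
  leftTriple-cases t@(triple _ c d d>0 d∣) with 0ℤ ℤ.<? (+ N ℤ.- (c ℤ.+ d) ℤ.* (c ℤ.+ d))
  ... | yes 0<gap = inj₁ (refl , 0<gap)
  ... | no  _     = inj₂ (refl , refl , cancel-d t _ _
          (trans (/-exact _ d {{positive⇒nonZero d>0}} (divides k gap≡)) gap≡))
    where
    k = d ℤ.+ (c ℤ.+ (c ℤ.- cofactor t))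
    alg : ∀ c d e → (c ℤ.+ d) ℤ.* (c ℤ.+ d) ℤ.- (e ℤ.* d ℤ.+ c ℤ.* c) ≡ (d ℤ.+ (c ℤ.+ (c ℤ.- e))) ℤ.* d
    alg = ℤ-Solver.solve-∀
    gap≡ : (c ℤ.+ d) ℤ.* (c ℤ.+ d) ℤ.- + N ≡ k ℤ.* d
    gap≡ = trans (cong (λ n → (c ℤ.+ d) ℤ.* (c ℤ.+ d) ℤ.- n) (N≡ t)) (alg c d (cofactor t))

  module _ (t : Triple) (c′≡ : c (leftTriple t) ≡ c t ℤ.- cofactor t)
           (d′≡ : d (leftTriple t) ≡ d t ℤ.+ (c t ℤ.+ (c t ℤ.- cofactor t))) where
    private
      t′ = leftTriple t

    -- Since `N - (c - e)² = e (d + 2c - e)`, the same `e` completes the left child.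
    cofactor-left : cofactor t ≡ cofactor t′
    cofactor-left = cancel-d t′ _ _ (begin
      cofactor t ℤ.* d t′
        ≡⟨ cong (cofactor t ℤ.*_) d′≡ ⟩
      cofactor t ℤ.* (d t ℤ.+ (c t ℤ.+ (c t ℤ.- cofactor t)))
        ≡⟨ alg (c t) (d t) (cofactor t) ⟩
      (cofactor t ℤ.* d t ℤ.+ c t ℤ.* c t) ℤ.- (c t ℤ.- cofactor t) ℤ.* (c t ℤ.- cofactor t)
        ≡⟨ cong₂ (λ n z → n ℤ.- z ℤ.* z) (N≡ t) c′≡ ⟨
      + N ℤ.- c t′ ℤ.* c t′
        ≡⟨ cofactor*d t′ ⟨
      cofactor t′ ℤ.* d t′ ∎)
      where
      open ≡-Reasoning
      alg : ∀ c d e → e ℤ.* (d ℤ.+ (c ℤ.+ (c ℤ.- e))) ≡ (e ℤ.* d ℤ.+ c ℤ.* c) ℤ.- (c ℤ.- e) ℤ.* (c ℤ.- e)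
      alg = ℤ-Solver.solve-∀

    d-left : d t′ ≡ d t ℤ.+ (c t ℤ.+ c t′)
    d-left = trans d′≡ (cong (λ z → d t ℤ.+ (c t ℤ.+ z)) (sym c′≡))

    leftTriple-step : formOf t ⟶[ left ] formOf t′
    leftTriple-step = subst (λ z → formOf t ⟶[ left ] ⟨ c t′ , d t′ , z ⟩) cofactor-left
      (⟶-left (trans (alg (c t) (cofactor t)) (cong (ℤ._+ cofactor t) (sym c′≡))) d-left (0<d t) (0<d t′))
      where
      alg : ∀ c e → c ≡ (c ℤ.- e) ℤ.+ e
      alg = ℤ-Solver.solve-∀

    -- The shape that `represents-left` expects, with `e` expressed through the two values of `c`.
    N≡left : + N ≡ c t ℤ.* c t ℤ.+ (c t ℤ.- c t′) ℤ.* d t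
    N≡left = trans (N≡ t) (trans (alg (c t) (d t) (cofactor t))
      (cong (λ z → c t ℤ.* c t ℤ.+ (c t ℤ.- z) ℤ.* d t) (sym c′≡)))
      where
      alg : ∀ c d e → e ℤ.* d ℤ.+ c ℤ.* c ≡ c ℤ.* c ℤ.+ (c ℤ.- (c ℤ.- e)) ℤ.* d
      alg = ℤ-Solver.solve-∀

-- The left-positive path and its reflection.

module Path (N : ℕ) .(N≢□ : NonSquare N) (p : ℤ) (p²<N : p ℤ.* p ℤ.< + N)
            (q : ℕ) .{{_ : NonZero q}} .(q∣ : + q ∣ + N ℤ.- p ℤ.* p) where
  open CalkinWilf N N≢□ hiding (_+_; _*_)
  open Tree p q q∣
  open Labels N
  open Triples N N≢□

  step-left : ∀ v → ε (leftTriple (tripleAt v)) ≡ Sign.+ → step v ≡ left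
  step-left v eq rewrite eq = refl

  step-right : ∀ v → ε (leftTriple (tripleAt v)) ≡ Sign.- → step v ≡ right
  step-right v eq rewrite eq = refl

  -- 0 < cofactor says c² < N.
  record OnPath (v : Vertex) : Set where
    field
      ε≡+        : ε (tripleAt v) ≡ Sign.+
      0<cofactor : 0ℤ ℤ.< cofactor (tripleAt v)
      represents : label v Represents c (tripleAt v) / d (tripleAt v)

  -- As `v` has sign `+`, a flipped left child is negative and sends the path right, where the sign
  -- is kept; an unflipped one is positive and is taken. The cofactor is positive by the inequality
  -- in the first case and unchanged in the second.
  advance : ∀ v → OnPath v →
            OnPath (step v ∷ v) × formOf (tripleAt v) ⟶[ step v ] formOf (tripleAt (step v ∷ v))
  advance v on with leftTriple-cases (tripleAt v)
  ... | inj₁ (ε′≡ , 0<gap) rewrite step-right v (trans ε′≡ (cong Sign.opposite (OnPath.ε≡+ on))) =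
    record
      { ε≡+        = OnPath.ε≡+ on
      ; 0<cofactor = 0<cofactor-right (tripleAt v) 0<gap
      ; represents = represents-right (OnPath.represents on)
      } ,
    rightTriple-step (tripleAt v) (OnPath.0<cofactor on) 0<gap
  ... | inj₂ (ε′≡ , c′≡ , d′≡) rewrite step-left v (trans ε′≡ (OnPath.ε≡+ on)) =
    record
      { ε≡+        = trans ε′≡ (OnPath.ε≡+ on)
      ; 0<cofactor = subst (0ℤ ℤ.<_) (cofactor-left t c′≡ d′≡) (OnPath.0<cofactor on)
      ; represents = represents-left (N≡left t c′≡ d′≡) (d-left t c′≡ d′≡) (0<d (leftTriple t)) (OnPath.represents on)
      } ,
    leftTriple-step t c′≡ d′≡
    where t = tripleAt v

  root-onPath : OnPath []
  root-onPath = record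
    { ε≡+        = refl
    -- The hypothesis `p²<N` enters here and starts the invariant.
    ; 0<cofactor = pos*pos (0<d t) (subst (0ℤ ℤ.<_) (sym (cofactor*d t)) (<⇒0<- p²<N))
    ; represents = represent (/-clear 1ℤ q) p/q
    }
    where
    t = tripleAt []
    p/q : p ℚ./ q ≡ ι p ℚ.* (1ℤ ℚ./ q)
    p/q = begin
      p ℚ./ q                                     ≡⟨ ℚ.*-identityʳ (p ℚ./ q) ⟨
      (p ℚ./ q) ℚ.* 1ℚ                            ≡⟨ cong ((p ℚ./ q) ℚ.*_) (/-clear 1ℤ q) ⟨
      (p ℚ./ q) ℚ.* ((1ℤ ℚ./ q) ℚ.* ι (+ q))      ≡⟨ alg (p ℚ./ q) (1ℤ ℚ./ q) (ι (+ q)) ⟩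
      ((p ℚ./ q) ℚ.* ι (+ q)) ℚ.* (1ℤ ℚ./ q)      ≡⟨ cong (ℚ._* (1ℤ ℚ./ q)) (/-clear p q) ⟩
      ι p ℚ.* (1ℤ ℚ./ q)                          ∎
      where
      open ≡-Reasoning
      alg : ∀ a b c → a ℚ.* (b ℚ.* c) ≡ (a ℚ.* c) ℚ.* b
      alg = solve-∀ ℚ-ring

  onPath : ∀ n → OnPath (lpp n)
  onPath zero    = root-onPath
  onPath (suc n) = proj₁ (advance (lpp n) (onPath n))

  tripleOf : ℕ → Triple
  tripleOf n = tripleAt (lpp n)

  form : ℕ → Form
  form n = formOf (tripleOf n)

  form-step : ∀ n → form n ⟶[ step (lpp n) ] form (suc n)
  form-step n = proj₂ (advance (lpp n) (onPath n))

  x-represents : ∀ n → x n Represents c (tripleOf n) / d (tripleOf n)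
  x-represents n = OnPath.represents (onPath n)

  x-injective : ∀ m n → x m ≡ x n → form m ≡ form n
  x-injective m n eq = form-determined (tripleOf m) (form n) (proj₁ cd≡) (proj₂ cd≡) (N≡ (tripleOf n))
    where
    cd≡ : c (tripleOf m) ≡ c (tripleOf n) × d (tripleOf m) ≡ d (tripleOf n)
    cd≡ = represents-injective (x-represents m)
      (subst (_Represents c (tripleOf n) / d (tripleOf n)) (sym eq) (x-represents n))

  -- Negating `c` preserves `c²`, so the same `e` completes both forms.
  conjugate⇒conj : ∀ m n → x m ≡ - x n ⋆ → form m ≡ conj (form n)
  conjugate⇒conj m n eq = form-determined (tripleOf m) (conj (form n)) (proj₁ cd≡) (proj₂ cd≡)
    (trans (N≡ (tripleOf n)) (alg (c (tripleOf n)) (d (tripleOf n)) (cofactor (tripleOf n))))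
    where
    cd≡ : c (tripleOf m) ≡ ℤ.- c (tripleOf n) × d (tripleOf m) ≡ d (tripleOf n)
    cd≡ = represents-injective (x-represents m)
      (subst (_Represents (ℤ.- c (tripleOf n)) / d (tripleOf n)) (sym eq) (represents-conj (x-represents n)))
    alg : ∀ c d e → e ℤ.* d ℤ.+ c ℤ.* c ≡ e ℤ.* d ℤ.+ (ℤ.- c) ℤ.* (ℤ.- c)
    alg = ℤ-Solver.solve-∀

  conj⇒conjugate : ∀ m n → form m ≡ conj (form n) → x m ≡ - x n ⋆
  conj⇒conjugate m n eq = represents-unique (x-represents m)
    (subst (λ s → - x n ⋆ Represents Form.c s / Form.d s) (sym eq) (represents-conj (x-represents n)))

  -- A mirrored pair of vertices stays mirrored when one moves down and the other
  -- up: conjugation reverses steps, and steps are deterministic.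
  mirror : ∀ k n → form (suc k) ≡ conj (form n) →
           step (lpp n) ≡ step (lpp k) × form k ≡ conj (form (suc n))
  mirror k n eq
    -- Two steps out of `form n` are compared: that of the path, and the reversal of the step from
    -- `k` to `suc k`, whose source `conj (form (suc k))` is `form n` by `eq`.
    with σ≡τ , form≡ ← ⟶-deterministic (form-step n)
           (subst (_⟶[ step (lpp k) ] conj (form k))
             (trans (cong conj eq) (conj-involutive (form n))) (⟶-reverse (form-step k))) =
    σ≡τ , trans (sym (conj-involutive (form k))) (cong conj (sym form≡))

  -- Induction on `n`, starting from the pair `m` and `0`. Writing the other index as `k` with
  -- `k + n ≡ m` exposes the successor that `mirror` consumes.
  mirrors : ∀ {m} → form m ≡ conj (form 0) → ∀ n {k} → k ℕ.+ n ≡ m → form k ≡ conj (form n)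
  mirrors eq zero    {k} refl rewrite ℕ.+-identityʳ k = eq
  mirrors eq (suc n) {k} k+n≡m = proj₂ (mirror k n (mirrors eq n (trans (sym (ℕ.+-suc k n)) k+n≡m)))

sameSide : ∀ {σ τ} → σ ≡ τ → (σ ≡ left × τ ≡ left) ⊎ (σ ≡ right × τ ≡ right)
sameSide {left}  refl = inj₁ (refl , refl)
sameSide {right} refl = inj₂ (refl , refl)

proposition4 : (N : ℕ) → .{{_ : NonZero N}} → (N≢□ : NonSquare N) →
    (p : ℤ) → p ℤ.* p ℤ.< + N →
    (q : ℕ) → .{{_ : NonZero q}} → (q∣ : + q ∣ + N ℤ.- p ℤ.* p) →
    let open CalkinWilf N N≢□
        open Tree p q q∣
    in
    (T : ℕ) → IsLeastPeriod T →
    (m : ℕ) → 1 ℕ.≤ m → m ℕ.≤ T → x m ≡ - α ⋆ →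
    (n : ℕ) → n ℕ.≤ m →
    x (m ∸ n) ≡ - (x n) ⋆
    × ((childSide T (suc n) ≡ left × childSide T (m ∸ n) ≡ left)
       ⊎ (childSide T (suc n) ≡ right × childSide T (m ∸ n) ≡ right))
proposition4 N N≢□ p p²<N q q∣ (suc T) (_ , xT≡α , _) m _ _ xm≡ n n≤m =
  conj⇒conjugate (m ∸ n) n mirrored , sameSide (sides (m ∸ n) mirrored)
  where
  open CalkinWilf N N≢□ using (module Tree)
  open Tree p q q∣
  open Path N N≢□ p p²<N q q∣
  mirrored : form (m ∸ n) ≡ conj (form n)
  mirrored = mirrors (conjugate⇒conj m 0 xm≡) n (ℕ.m∸n+n≡m n≤m)
  sides : ∀ k → form k ≡ conj (form n) → childSide (suc T) (suc n) ≡ childSide (suc T) k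
  -- The least period is `suc T` here. The root counts as vertex `suc T`, which has the same form by
  -- periodicity, so its parent is vertex `T`.
  sides zero    eq = proj₁ (mirror T n (trans (x-injective (suc T) 0 xT≡α) eq))
  sides (suc k) eq = proj₁ (mirror k n eq)
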